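{- Let $n\ge 1$ and $1\le i\le n$. For $\pi\in\mathcal S_n(321)$ let $\ell_i(\pi)=\chi_{\pi^{ -1}(i)\le i}+\chi_{\pi(i)>i}$. Then the statistic $\ell_i$ is $1$-mesic under the action of rowmotion $\rho_{\mathcal S}$ on $\mathcal S_n(321)$; that is, for every orbit $\mathcal O$ of $\rho_{\mathcal S}$ on $\mathcal S_n(321)$, $\frac{1}{|\mathcal O|}\sum_{\pi\in\mathcal O}\ell_i(\pi)=1$.
   Context: $\chi_B$ equals $1$ if the statement $B$ is true and $0$ otherwise. $\mathcal S_n(321)$ is the set of permutations $\pi$ of $\{1,\dots,n\}$ that are $321$-avoiding: there are no $i<j<k$ with $\pi(i)>\pi(j)>\pi(k)$. $\mathbf A^{n-1}$ is the poset of intervals $\{[i,j]:1\le i\le j\le n-1\}$ ordered by inclusion (type $A$ positive root poset), and $\mathcal A(\mathbf A^{n-1})$ is its set of antichains. Antichain rowmotion $\rho_{\mathcal A}:\mathcal A(\mathbf A^{n-1})\to\mathcal A(\mathbf A^{n-1})$ sends an antichain $A$ to the set of minimal elements of the complement of the order ideal $\{x: x\le y\text{ for some }y\in A\}$ generated by $A$; it is a bijection. The map $\mathrm{Exc}:\mathcal S_n(321)\to\mathcal A(\mathbf A^{n-1})$, $\mathrm{Exc}(\pi)=\{[i,\pi(i)-1]:\pi(i)>i\}$, is a bijection. Rowmotion on $321$-avoiding permutations is $\rho_{\mathcal S}=\mathrm{Exc}^{ -1}\circ\rho_{\mathcal A}\circ\mathrm{Exc}$. -}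

module Defs where

open import Data.Bool.Base using (Bool; true; false; if_then_else_)
import Data.Bool.Properties as Bool
open import Data.Fin.Base as Fin using (Fin; zero; suc; toℕ; fromℕ<; inject≤)
import Data.Fin.Properties as Fin
open import Data.Fin.Permutation
  using (Permutation′; permutation; _⟨$⟩ʳ_; _⟨$⟩ˡ_; inverseˡ; inverseʳ; _∘ₚ_; transpose)
import Data.Fin.Permutation as Perm
import Data.Fin.Permutation.Components as PC
import Data.Integer.Base as ℤ
open import Data.List.Base using (applyUpTo; deduplicate; drop)
import Data.List.Membership.Setoid as Membership
open import Data.List.Membership.Setoid.Properties
  using (∈-applyUpTo⁺; ∈-applyUpTo⁻; ∈-deduplicate⁺; ∈-deduplicate⁻; ∈-resp-≈)
open import Data.List.Relation.Unary.Unique.DecSetoid.Properties using (deduplicate-!)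
import Data.List.Relation.Unary.Unique.Setoid as Unique
open import Data.List.NonEmpty.Base as List⁺ using (List⁺; toList)
open import Data.Nat.Base
  using (ℕ; zero; suc; _+_; _∸_; _≤_; _<_; z≤n; s≤s)
open import Data.Nat.GeneralisedArithmetic using (fold; fold-+)
open import Data.Nat.Induction using (<-wellFounded; Acc; acc)
import Data.Nat.ListAction as ListAction
import Data.Nat.Properties as ℕ
open import Data.Product.Base using (Σ; ∃; _×_; _,_; proj₁; proj₂)
open import Data.Rational.Base using (ℚ; _/_)
open import Data.Sum.Base using (_⊎_; inj₁; inj₂)
open import Function.Base using (_∘_; id)
open import Function.Bundles
  using (Bijection; Inverse; _⇔_; mk⇔; module Equivalence)
import Function.Construct.Identity as Id
import Function.Construct.Symmetry as Sym
import Function.Construct.Composition as Comp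
open import Function.Properties.Bijection using (Bijection⇒Inverse)
open import Level using (0ℓ; _⊔_) renaming (suc to lsuc)
open import Relation.Binary.Bundles using (Setoid; DecSetoid; Poset)
open import Relation.Binary.Definitions using (tri<; tri≈; tri>)
open import Relation.Binary.PropositionalEquality as ≡
  using (_≡_; refl; sym; trans; cong; cong₂; subst; subst₂)
open import Relation.Nullary
  using (¬_; Dec; yes; no; does; contradiction; ¬?; _×-dec_; _→-dec_)
open import Relation.Nullary.Decidable using (map′; dec-true; dec-false; decidable-stable)
open import Relation.Unary using (Pred; Decidable; ∁)

χ : ∀ {p} {B : Set p} → Dec B → ℕ
χ B? = if does B? then 1 else 0

Avoids321 : ∀ {n} → Permutation′ n → Set
Avoids321 {n} π = ∀ {i j k : Fin n} → i Fin.< j → j Fin.< k →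
  ¬ ((π ⟨$⟩ʳ j) Fin.< (π ⟨$⟩ʳ i) × (π ⟨$⟩ʳ k) Fin.< (π ⟨$⟩ʳ j))

record S321 (n : ℕ) : Set where
  constructor mkS321
  field
    perm   : Permutation′ n
    avoids : Avoids321 perm

open S321 public

S321-setoid : ℕ → Setoid 0ℓ 0ℓ
S321-setoid n = record
  { Carrier       = S321 n
  ; _≈_           = λ π σ → perm π Perm.≈ perm σ
  ; isEquivalence = record
    { refl  = λ _ → refl
    ; sym   = λ e i → sym (e i)
    ; trans = λ e f i → trans (e i) (f i)
    }
  }

module _ {c ℓ₁ ℓ₂} (P : Poset c ℓ₁ ℓ₂) where
  open Poset P renaming (Carrier to X; _≤_ to _⊑_)

  IsAntichain : ∀ {ℓ} → Pred X ℓ → Set _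
  IsAntichain S = ∀ {x y} → S x → S y → x ⊑ y → x ≈ y

  IdealGeneratedBy : ∀ {ℓ} → Pred X ℓ → Pred X _
  IdealGeneratedBy S x = ∃ λ y → S y × x ⊑ y

  MinimalElements : ∀ {ℓ} → Pred X ℓ → Pred X _
  MinimalElements S x = S x × (∀ y → S y → y ⊑ x → y ≈ x)

record Interval (m : ℕ) : Set where
  constructor [_,_]⟨_,_,_⟩
  field
    lo hi : ℕ
    1≤lo  : 1 ≤ lo
    lo≤hi : lo ≤ hi
    hi≤m  : hi ≤ m

open Interval public

interval-≡ : ∀ {m} {x y : Interval m} → lo x ≡ lo y → hi x ≡ hi y → x ≡ y
interval-≡ {x = [ a , b ]⟨ p , q , r ⟩} {[ a , b ]⟨ p′ , q′ , r′ ⟩} refl refl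
  rewrite ℕ.≤-irrelevant p p′ | ℕ.≤-irrelevant q q′ | ℕ.≤-irrelevant r r′ = refl

infix 4 _⊆_

_⊆_ : ∀ {m} → Interval m → Interval m → Set
x ⊆ y = lo y ≤ lo x × hi x ≤ hi y

𝐀 : ℕ → Poset 0ℓ 0ℓ 0ℓ
𝐀 m = record
  { Carrier        = Interval m
  ; _≈_            = _≡_
  ; _≤_            = _⊆_
  ; isPartialOrder = record
    { isPreorder = record
      { isEquivalence = ≡.isEquivalence
      ; reflexive     = λ { refl → ℕ.≤-refl , ℕ.≤-refl }
      ; trans         = λ (p , q) (r , s) → ℕ.≤-trans r p , ℕ.≤-trans q s
      }
    ; antisym = λ (p , q) (r , s) →
        interval-≡ (ℕ.≤-antisym r p) (ℕ.≤-antisym q s)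
    }
  }

-- Membership is required to be decidable, so that these are the antichains
-- of a finite poset in the classical sense.
record Antichain (m : ℕ) : Set₁ where
  field
    Member    : Pred (Interval m) 0ℓ
    member?   : Decidable Member
    antichain : IsAntichain (𝐀 m) Member

open Antichain public

Antichain-setoid : ℕ → Setoid (lsuc 0ℓ) 0ℓ
Antichain-setoid m = record
  { Carrier       = Antichain m
  ; _≈_           = λ A B → ∀ x → Member A x ⇔ Member B x
  ; isEquivalence = record
    { refl  = λ _ → Id.⇔-id _
    ; sym   = λ e x → Sym.⇔-sym (e x)
    ; trans = λ e f x → f x Comp.⇔-∘ e x
    }
  }

anyInterval? : ∀ {m ℓ} {Q : Pred (Interval m) ℓ} → Decidable Q → Dec (∃ Q)
anyInterval? {m} {Q = Q} Q? =
  map′ (λ (_ , _ , p , q , r , z) → [ _ , _ ]⟨ p , q , r ⟩ , z) from′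
       (Fin.any? λ a → Fin.any? λ b → at? (toℕ a) (toℕ b))
  where
  At : ℕ → ℕ → Set _
  At a b = Σ (1 ≤ a) λ p → Σ (a ≤ b) λ q → Σ (b ≤ m) λ r → Q [ a , b ]⟨ p , q , r ⟩

  at? : ∀ a b → Dec (At a b)
  at? a b with 1 ℕ.≤? a | a ℕ.≤? b | b ℕ.≤? m
  ... | no ¬p | _     | _     = no λ (p , _) → ¬p p
  ... | yes _ | no ¬q | _     = no λ (_ , q , _) → ¬q q
  ... | yes _ | yes _ | no ¬r = no λ (_ , _ , r , _) → ¬r r
  ... | yes p | yes q | yes r = map′ (λ z → p , q , r , z)
    (λ (p′ , q′ , r′ , z) → subst Q (interval-≡ refl refl) z) (Q? _)

  from′ : ∃ Q → ∃ λ (a : Fin (suc m)) → ∃ λ (b : Fin (suc m)) → At (toℕ a) (toℕ b)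
  from′ (x@([ a , b ]⟨ p , q , r ⟩) , z) = fromℕ< a< , fromℕ< b< ,
    subst₂ At (sym (Fin.toℕ-fromℕ< a<)) (sym (Fin.toℕ-fromℕ< b<)) (p , q , r , z)
    where
    b< = s≤s r
    a< = s≤s (ℕ.≤-trans q r)

allInterval? : ∀ {m ℓ} {Q : Pred (Interval m) ℓ} → Decidable Q → Dec (∀ x → Q x)
allInterval? Q? = map′
  (λ ¬∃ x → decidable-stable (Q? x) λ ¬q → ¬∃ (x , ¬q))
  (λ f (x , ¬q) → ¬q (f x))
  (¬? (anyInterval? (¬? ∘ Q?)))

_⊆?_ : ∀ {m} (x y : Interval m) → Dec (x ⊆ y)
x ⊆? y = (lo y ℕ.≤? lo x) ×-dec (hi x ℕ.≤? hi y)

_≟ᴵ_ : ∀ {m} (x y : Interval m) → Dec (x ≡ y)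
x ≟ᴵ y = map′ (λ (p , q) → interval-≡ p q) (λ { refl → refl , refl })
  ((lo x ℕ.≟ lo y) ×-dec (hi x ℕ.≟ hi y))

ρ𝒜 : ∀ {m} → Antichain m → Antichain m
ρ𝒜 {m} A = record
  { Member    = MinimalElements (𝐀 m) (∁ (IdealGeneratedBy (𝐀 m) (Member A)))
  ; member?   = λ x → ∁↓? x ×-dec allInterval? λ y → ∁↓? y →-dec ((y ⊆? x) →-dec (y ≟ᴵ x))
  ; antichain = λ (x∉ , _) (_ , y-min) x⊆y → y-min _ x∉ x⊆y
  }
  where
  ∁↓? : Decidable (∁ (IdealGeneratedBy (𝐀 m) (Member A)))
  ∁↓? x = ¬? (anyInterval? λ y → member? A y ×-dec (x ⊆? y))

module _ {n} (π : Permutation′ n) where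

  ⟨$⟩ʳ-injective : ∀ {i j} → π ⟨$⟩ʳ i ≡ π ⟨$⟩ʳ j → i ≡ j
  ⟨$⟩ʳ-injective e = trans (sym (inverseˡ π)) (trans (cong (π ⟨$⟩ˡ_) e) (inverseˡ π))

  initial-segment-≤ : ∀ {u v} → u ≤ n →
    (∀ k → toℕ k < u → toℕ (π ⟨$⟩ʳ k) < v) → u ≤ v
  initial-segment-≤ {u} {v} u≤n h = Fin.injective⇒≤ {f = f} λ {x} {y} e →
    Fin.inject≤-injective u≤n u≤n x y
      (⟨$⟩ʳ-injective (Fin.toℕ-injective
        (trans (sym (Fin.toℕ-fromℕ< _)) (trans (cong toℕ e) (Fin.toℕ-fromℕ< _)))))
    where
    f : Fin u → Fin v
    f x = fromℕ< (h (inject≤ x u≤n)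
      (subst (_< u) (sym (Fin.toℕ-inject≤ x u≤n)) (Fin.toℕ<n x)))

-- To the right of an exceedance there is a smaller value.
exceedance-descends : ∀ {n} (π : Permutation′ n) {i} → i Fin.< (π ⟨$⟩ʳ i) →
  ∃ λ k → i Fin.< k × (π ⟨$⟩ʳ k) Fin.< (π ⟨$⟩ʳ i)
exceedance-descends {n} π {i} i<πi =
  decidable-stable (Fin.any? λ k → (i Fin.<? k) ×-dec ((π ⟨$⟩ʳ k) Fin.<? (π ⟨$⟩ʳ i)))
  λ ¬∃ → ℕ.<⇒≱ i<πi (initial-segment-≤ (Perm.flip π) (ℕ.<⇒≤ (Fin.toℕ<n (π ⟨$⟩ʳ i)))
    λ v v<πi → ℕ.≤∧≢⇒<
      (ℕ.≮⇒≥ λ i<k → ¬∃ (π ⟨$⟩ˡ v , i<k , subst (Fin._< (π ⟨$⟩ʳ i)) (sym (inverseʳ π)) v<πi))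
      λ e → ℕ.<-irrefl (cong toℕ (trans (sym (inverseʳ π)) (cong (π ⟨$⟩ʳ_) (Fin.toℕ-injective e))))
                       v<πi)

module _ {n} (π : S321 n) where

  private
    f : Fin n → Fin n
    f = perm π ⟨$⟩ʳ_

  exceedances-increase : ∀ {i j} → i Fin.< j → j Fin.< f j → f i Fin.< f j
  exceedances-increase {i} {j} i<j j<fj with ℕ.<-cmp (toℕ (f i)) (toℕ (f j))
  ... | tri< lt _ _ = lt
  ... | tri≈ _ e _  = contradiction i<j
    (ℕ.<-irrefl (cong toℕ (⟨$⟩ʳ-injective (perm π) (Fin.toℕ-injective e))))
  ... | tri> _ _ gt with k , j<k , fk<fj ← exceedance-descends (perm π) j<fj =
    contradiction (gt , fk<fj) (avoids π i<j j<k)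

  non-exceedances-increase : ∀ {i j} → i Fin.< j → f i Fin.≤ i → f i Fin.< f j
  non-exceedances-increase {i} {j} i<j fi≤i with ℕ.<-cmp (toℕ (f i)) (toℕ (f j))
  ... | tri< lt _ _ = lt
  ... | tri≈ _ e _  = contradiction i<j
    (ℕ.<-irrefl (cong toℕ (⟨$⟩ʳ-injective (perm π) (Fin.toℕ-injective e))))
  ... | tri> _ _ fj<fi = contradiction fi≤i (ℕ.<⇒≱
    (initial-segment-≤ (transpose i j ∘ₚ perm π) (Fin.toℕ<n i) below))
    where
    small : ∀ k → k Fin.< i → f k Fin.< f i
    small k k<i with ℕ.<-cmp (toℕ (f k)) (toℕ (f i))
    ... | tri< lt _ _ = lt
    ... | tri≈ _ e _  = contradiction k<i
      (ℕ.<-irrefl (cong toℕ (⟨$⟩ʳ-injective (perm π) (Fin.toℕ-injective e))))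
    ... | tri> _ _ gt = contradiction (gt , fj<fi) (avoids π k<i i<j)

    below : ∀ k → toℕ k < suc (toℕ i) → f (PC.transpose i j k) Fin.< f i
    below k (s≤s k≤i) with k Fin.≟ i
    ... | yes _ = fj<fi
    ... | no k≢i with k Fin.≟ j
    ...   | yes refl = contradiction k≤i (ℕ.<⇒≱ i<j)
    ...   | no _ = small k (ℕ.≤∧≢⇒< k≤i (k≢i ∘ Fin.toℕ-injective))

-- Elements of Fin n are 0-based but intervals are 1-based: for the position
-- i + 1 with value π(i) + 1, the interval from the position to one less than the
-- value is [i + 1, π(i)].
Exc : ∀ {n} → S321 n → Antichain (n ∸ 1)
Exc {n} π = record
  { Member    = λ x → ∃ λ i → i Fin.< f i × lo x ≡ suc (toℕ i) × hi x ≡ toℕ (f i)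
  ; member?   = λ x → Fin.any? λ i → (i Fin.<? f i) ×-dec
                  ((lo x ℕ.≟ suc (toℕ i)) ×-dec (hi x ℕ.≟ toℕ (f i)))
  ; antichain = anti
  }
  where
  f : Fin n → Fin n
  f = perm π ⟨$⟩ʳ_
  anti : IsAntichain (𝐀 (n ∸ 1)) _
  anti {x} {y} (i , i< , xi , xf) (j , j< , yj , yf) (lo≤ , hi≤)
    with ℕ.<-cmp (toℕ j) (toℕ i)
  ... | tri< j<i _ _ = contradiction (subst₂ _≤_ xf yf hi≤)
                         (ℕ.<⇒≱ (exceedances-increase π j<i i<))
  ... | tri> _ _ i<j = contradiction (ℕ.≤-pred (subst₂ _≤_ yj xi lo≤)) (ℕ.<⇒≱ i<j)
  ... | tri≈ _ e _ with refl ← Fin.toℕ-injective e =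
    interval-≡ (trans xi (sym yj)) (trans xf (sym yf))

-- Bijectivity of Exc: a 321-avoiding permutation increases on its exceedances and on its
-- non-exceedances.  Colour positions and values by whether they belong to an
-- exceedance; the permutation is then the colour-preserving bijection which
-- is increasing on each colour, i.e. preserves the rank within each colour.

-- The number of l < k with c l ≡ b.
rank : (ℕ → Bool) → Bool → ℕ → ℕ
rank c b zero    = 0
rank c b (suc k) = (if does (c k Bool.≟ b) then suc else id) (rank c b k)

module _ (c : ℕ → Bool) (b : Bool) where

  rank-yes : ∀ {k} → c k ≡ b → rank c b (suc k) ≡ suc (rank c b k)
  rank-yes {k} e rewrite dec-true (c k Bool.≟ b) e = refl

  rank-step : ∀ k → rank c b k ≤ rank c b (suc k)
  rank-step k with does (c k Bool.≟ b)
  ... | true  = ℕ.n≤1+n _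
  ... | false = ℕ.≤-refl

  rank-mono : ∀ {k l} → k ≤ l → rank c b k ≤ rank c b l
  rank-mono {l = zero}  z≤n = ℕ.≤-refl
  rank-mono {k} {suc l} k≤l with ℕ.m≤n⇒m<n∨m≡n k≤l
  ... | inj₁ k<l  = ℕ.≤-trans (rank-mono (ℕ.≤-pred k<l)) (rank-step l)
  ... | inj₂ refl = ℕ.≤-refl

  rank-strict : ∀ {k l} → c k ≡ b → k < l → rank c b k < rank c b l
  rank-strict {k} {l} e k<l =
    ℕ.≤-trans (ℕ.≤-reflexive (sym (rank-yes e))) (rank-mono {suc k} {l} k<l)

  rank-injective : ∀ {k l} → c k ≡ b → c l ≡ b → rank c b k ≡ rank c b l → k ≡ l
  rank-injective {k} {l} ck cl e with ℕ.<-cmp k l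
  ... | tri< lt _ _ = contradiction e (ℕ.<⇒≢ (rank-strict ck lt))
  ... | tri≈ _ k≡l _ = k≡l
  ... | tri> _ _ gt = contradiction (sym e) (ℕ.<⇒≢ (rank-strict cl gt))

  select : ∀ {r} k → r < rank c b k → ∃ λ l → l < k × c l ≡ b × rank c b l ≡ r
  select {r} (suc k) r< with c k Bool.≟ b
  ... | no _ = let l , l<k , p = select k r< in l , ℕ.m<n⇒m<1+n l<k , p
  ... | yes e with ℕ.m≤n⇒m<n∨m≡n (ℕ.≤-pred r<)
  ...   | inj₁ lt   = let l , l<k , p = select k lt in l , ℕ.m<n⇒m<1+n l<k , p
  ...   | inj₂ refl = k , ℕ.n<1+n k , e , refl

rank-cong : ∀ {c d} b → (∀ k → c k ≡ d k) → ∀ k → rank c b k ≡ rank d b k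
rank-cong b e zero    = refl
rank-cong b e (suc k) rewrite e k | rank-cong b e k = refl

rank-complement : ∀ c k → rank c false k + rank c true k ≡ k
rank-complement c zero = refl
rank-complement c (suc k) with c k
... | true  = trans (ℕ.+-suc _ _) (cong suc (rank-complement c k))
... | false = cong suc (rank-complement c k)

-- If C lets every b-coloured position below p be matched with one below q,
-- then there are at most as many of the former as of the latter.
rank-simulation : ∀ {ℓ} c d b (C : ℕ → ℕ → Set ℓ) →
  (∀ {p q} → C p q → ∀ {p′} → p′ < p → c p′ ≡ b →
    ∃ λ q′ → q′ < q × d q′ ≡ b × C p′ q′) →
  ∀ {p q} → C p q → rank c b p ≤ rank d b q
rank-simulation c d b C sim Cpq = go _ Cpq refl
  where
  go : ∀ r {p q} → C p q → rank c b p ≡ r → rank c b p ≤ rank d b q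
  go zero    Cpq e rewrite e = z≤n
  go (suc r) {p} {q} Cpq e
    with p′ , p′<p , cp′ , e′ ← select c b {r} p (subst (r <_) (sym e) (ℕ.n<1+n r))
    with q′ , q′<q , dq′ , Cp′q′ ← sim Cpq p′<p cp′ = begin
      rank c b p         ≡⟨ trans e (cong suc (sym e′)) ⟩
      suc (rank c b p′)  ≤⟨ s≤s (go r Cp′q′ e′) ⟩
      suc (rank d b q′)  ≤⟨ rank-strict d b dq′ q′<q ⟩
      rank d b q         ∎
    where open ℕ.≤-Reasoning

record Match (c d : ℕ → Bool) (p q : ℕ) : Set where
  constructor _,_
  field
    colour-≡ : d q ≡ c p
    rank-≡   : rank d (d q) q ≡ rank c (c p) p

Match-sym : ∀ {c d p q} → Match c d p q → Match d c q p
Match-sym (e , r) = sym e , sym r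

Match-unique : ∀ {c d p q q′} → Match c d p q → Match c d p q′ → q ≡ q′
Match-unique {c} {d} {p} {q} {q′} (e , r) (e′ , r′) =
  rank-injective d (c p) e e′
    (trans (subst (λ b → rank d b q ≡ rank c (c p) p) e r)
           (sym (subst (λ b → rank d b q′ ≡ rank c (c p) p) e′ r′)))

match : ∀ {c d n} → (∀ b → rank c b n ≡ rank d b n) →
  (i : Fin n) → ∃ λ (j : Fin n) → Match c d (toℕ i) (toℕ j)
match {c} {d} {n} total i
  with q , q<n , e , r ← select d (c (toℕ i)) n
         (subst (rank c _ (toℕ i) <_) (total _) (rank-strict c _ refl (Fin.toℕ<n i)))
  = fromℕ< q<n , subst (Match c d (toℕ i)) (sym (Fin.toℕ-fromℕ< q<n))
      (e , trans (cong (λ b → rank d b q) e) r)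

module Matching {c d n} (total : ∀ b → rank c b n ≡ rank d b n) where

  private
    total′ : ∀ b → rank d b n ≡ rank c b n
    total′ b = sym (total b)

  matching : Permutation′ n
  matching = permutation (proj₁ ∘ match {c} {d} total) (proj₁ ∘ match {d} {c} total′)
    (λ j → Fin.toℕ-injective (Match-unique {c} {d} (proj₂ (match {c} {d} total _))
      (Match-sym {d} {c} (proj₂ (match {d} {c} total′ j)))))
    (λ i → Fin.toℕ-injective (Match-unique {d} {c} (proj₂ (match {d} {c} total′ _))
      (Match-sym {c} {d} (proj₂ (match {c} {d} total i)))))

  matching-Match : ∀ i → Match c d (toℕ i) (toℕ (matching ⟨$⟩ʳ i))
  matching-Match i = proj₂ (match {c} {d} total i)

  matching-increases : ∀ {i j} → i Fin.< j → c (toℕ i) ≡ c (toℕ j) →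
    (matching ⟨$⟩ʳ i) Fin.< (matching ⟨$⟩ʳ j)
  matching-increases {i} {j} i<j e = ℕ.≰⇒> λ fj≤fi →
    ℕ.<⇒≱ (rank-strict c _ e i<j)
      (subst₂ _≤_ (at j refl) (at i e) (rank-mono d _ fj≤fi))
    where
    at : ∀ k → c (toℕ k) ≡ c (toℕ j) →
      rank d (c (toℕ j)) (toℕ (matching ⟨$⟩ʳ k)) ≡ rank c (c (toℕ j)) (toℕ k)
    at k e′ with p , r ← matching-Match k =
      trans (cong (λ b → rank d b (toℕ (matching ⟨$⟩ʳ k))) (sym (trans p e′)))
            (trans r (cong (λ b → rank c b (toℕ k)) e′))

  -- Of three positions, two have the same colour.
  matching-avoids : Avoids321 matching
  matching-avoids {i} {j} {k} i<j j<k (fj<fi , fk<fj)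
    with c (toℕ i) Bool.≟ c (toℕ j) | c (toℕ j) Bool.≟ c (toℕ k)
       | c (toℕ i) Bool.≟ c (toℕ k)
  ... | yes e | _     | _     = ℕ.<-asym fj<fi (matching-increases i<j e)
  ... | no _  | yes e | _     = ℕ.<-asym fk<fj (matching-increases j<k e)
  ... | no _  | no _  | yes e =
    ℕ.<-asym (ℕ.<-trans fk<fj fj<fi) (matching-increases (ℕ.<-trans i<j j<k) e)
  ... | no p  | no q  | no r  = r (trans (Bool.¬-not p) (sym (Bool.¬-not (q ∘ sym))))

-- The colourings of the 0-based positions and values given by an antichain.
module _ {m} (A : Antichain m) where

  startAt? : ∀ k → Dec (∃ λ x → Member A x × lo x ≡ suc k)
  startAt? k = anyInterval? λ x → member? A x ×-dec (lo x ℕ.≟ suc k)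

  endAt? : ∀ k → Dec (∃ λ x → Member A x × hi x ≡ k)
  endAt? k = anyInterval? λ x → member? A x ×-dec (hi x ℕ.≟ k)

  start end : ℕ → Bool
  start = does ∘ startAt?
  end   = does ∘ endAt?

does-true : ∀ {p} {P : Set p} (P? : Dec P) → does P? ≡ true → P
does-true (yes p) _ = p

does-false : ∀ {p} {P : Set p} (P? : Dec P) → does P? ≡ false → ¬ P
does-false (no ¬p) _ = ¬p

module _ {m} (A : Antichain m) {x y} (x∈A : Member A x) (y∈A : Member A y) where

  lo<⇒hi< : lo x < lo y → hi x < hi y
  lo<⇒hi< lt = ℕ.≰⇒> λ hi≤ →
    ℕ.<-irrefl (cong lo (sym (antichain A y∈A x∈A (ℕ.<⇒≤ lt , hi≤)))) lt

  hi<⇒lo< : hi x < hi y → lo x < lo y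
  hi<⇒lo< lt = ℕ.≰⇒> λ lo≤ →
    ℕ.<-irrefl (cong hi (antichain A x∈A y∈A (lo≤ , ℕ.<⇒≤ lt))) lt

  lo≡⇒hi≡ : lo x ≡ lo y → hi x ≡ hi y
  lo≡⇒hi≡ e with ℕ.≤-total (hi x) (hi y)
  ... | inj₁ h = cong hi (antichain A x∈A y∈A (ℕ.≤-reflexive (sym e) , h))
  ... | inj₂ h = cong hi (sym (antichain A y∈A x∈A (ℕ.≤-reflexive e , h)))

lo≡suc : ∀ {m} (x : Interval m) → ∃ λ p → lo x ≡ suc p
lo≡suc x with lo x | 1≤lo x
... | suc p | _ = p , refl

module FromAntichain {n} (A : Antichain (n ∸ 1)) where

  private
    hi<n : ∀ {p} → p < n → (x : Interval (n ∸ 1)) → hi x < n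
    hi<n (s≤s _) x = s≤s (hi≤m x)

    Cut : ℕ → ℕ → Set
    Cut p q = (p ≡ n × q ≡ n) ⊎ (∃ λ x → Member A x × lo x ≡ suc p × hi x ≡ q)

    forth : ∀ {p q} → Cut p q → ∀ {p′} → p′ < p → start A p′ ≡ true →
      ∃ λ q′ → q′ < q × end A q′ ≡ true × Cut p′ q′
    forth {p} {q} Cpq {p′} p′<p s with x′ , x′∈A , e′ ← does-true (startAt? A p′) s =
      hi x′ , less Cpq , dec-true (endAt? A _) (x′ , x′∈A , refl) , inj₂ (x′ , x′∈A , e′ , refl)
      where
      less : Cut p q → hi x′ < q
      less (inj₁ (refl , refl))      = hi<n p′<p x′
      less (inj₂ (x , x∈A , e , refl)) =
        lo<⇒hi< A x′∈A x∈A (subst₂ _<_ (sym e′) (sym e) (s≤s p′<p))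

    back : ∀ {q p} → Cut p q → ∀ {q′} → q′ < q → end A q′ ≡ true →
      ∃ λ p′ → p′ < p × start A p′ ≡ true × Cut p′ q′
    back {q} {p} Cpq {q′} q′<q s
      with x′ , x′∈A , refl ← does-true (endAt? A q′) s
      with p′ , e′ ← lo≡suc x′ =
      p′ , less Cpq , dec-true (startAt? A _) (x′ , x′∈A , e′) , inj₂ (x′ , x′∈A , e′ , refl)
      where
      less : Cut p q → p′ < p
      less (inj₁ (refl , refl))      =
        ℕ.<-trans (subst (_≤ hi x′) e′ (lo≤hi x′)) q′<q
      less (inj₂ (x , x∈A , e , refl)) =
        ℕ.≤-pred (subst₂ _<_ e′ e (hi<⇒lo< A x′∈A x∈A q′<q))

    rank-Cut : ∀ {p q} → Cut p q → rank (start A) true p ≡ rank (end A) true q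
    rank-Cut Cpq = ℕ.≤-antisym
      (rank-simulation (start A) (end A) true Cut forth Cpq)
      (rank-simulation (end A) (start A) true (λ q p → Cut p q) back Cpq)

    total : ∀ b → rank (start A) b n ≡ rank (end A) b n
    total true  = rank-Cut (inj₁ (refl , refl))
    total false = ℕ.+-cancelʳ-≡ (rank (start A) true n) _ _
      (trans (rank-complement (start A) n)
        (sym (trans (cong (rank (end A) false n +_) (total true)) (rank-complement (end A) n))))

  open Matching {start A} {end A} {n} total public

  permutationOf : S321 n
  permutationOf = mkS321 matching matching-avoids

  private
    f : Fin n → Fin n
    f = matching ⟨$⟩ʳ_

    -- The permutation pairs up the endpoints as the antichain does.
    on-start : ∀ {x} i → Member A x → lo x ≡ suc (toℕ i) → hi x ≡ toℕ (f i)
    on-start {x} i x∈A e = Match-unique {start A} {end A} hi-match (matching-Match i)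
      where
      s≡true : start A (toℕ i) ≡ true
      s≡true = dec-true (startAt? A _) (x , x∈A , e)
      e≡true : end A (hi x) ≡ true
      e≡true = dec-true (endAt? A _) (x , x∈A , refl)
      hi-match : Match (start A) (end A) (toℕ i) (hi x)
      hi-match = trans e≡true (sym s≡true)
        , trans (cong (λ b → rank (end A) b (hi x)) e≡true)
            (trans (sym (rank-Cut (inj₂ (x , x∈A , e , refl))))
              (cong (λ b → rank (start A) b (toℕ i)) (sym s≡true)))

    ends-≤-starts : ∀ k → rank (end A) true (suc k) ≤ rank (start A) true k
    ends-≤-starts k =
      rank-simulation (end A) (start A) true C sim {suc k} {k} (inj₁ refl)
      where
      C : ℕ → ℕ → Set
      C q p = q ≡ suc p ⊎ Cut p q
      sim : ∀ {q p} → C q p → ∀ {q′} → q′ < q → end A q′ ≡ true →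
        ∃ λ p′ → p′ < p × start A p′ ≡ true × C q′ p′
      sim (inj₂ Cpq) q′<q s with p′ , lt , s′ , C′ ← back Cpq q′<q s =
        p′ , lt , s′ , inj₂ C′
      sim (inj₁ refl) {q′} q′<q s
        with x′ , x′∈A , refl ← does-true (endAt? A q′) s
        with p′ , e′ ← lo≡suc x′ =
        p′ , ℕ.≤-trans (subst (_≤ hi x′) e′ (lo≤hi x′)) (ℕ.≤-pred q′<q)
           , dec-true (startAt? A _) (x′ , x′∈A , e′) , inj₂ (inj₂ (x′ , x′∈A , e′ , refl))

    non-start′ : ∀ p q → Match (start A) (end A) p q → start A p ≡ false → q ≤ p
    non-start′ p zero    _       s = z≤n
    non-start′ p (suc k) (e , r) s = ℕ.≰⇒> λ p≤k → ℕ.<-irrefl refl (begin-strict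
      suc k                                              ≡⟨ rank-complement (end A) (suc k) ⟨
      rank (end A) false (suc k) + rank (end A) true (suc k)
        ≡⟨ cong (_+ rank (end A) true (suc k)) rank≡ ⟩
      rank (start A) false p + rank (end A) true (suc k)
        ≤⟨ ℕ.+-mono-≤ (rank-mono (start A) false p≤k) (ends-≤-starts k) ⟩
      rank (start A) false k + rank (start A) true k     ≡⟨ rank-complement (start A) k ⟩
      k                                                  <⟨ ℕ.n<1+n k ⟩
      suc k                                              ∎)
      where
      open ℕ.≤-Reasoning hiding (start)
      rank≡ : rank (end A) false (suc k) ≡ rank (start A) false p
      rank≡ = subst₂ (λ b b′ → rank (end A) b (suc k) ≡ rank (start A) b′ p)
                (trans e s) s r

    non-start : ∀ i → start A (toℕ i) ≡ false → f i Fin.≤ i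
    non-start i = non-start′ (toℕ i) (toℕ (f i)) (matching-Match i)

  Exc-permutationOf : ∀ x → Member (Exc permutationOf) x ⇔ Member A x
  Exc-permutationOf x = mk⇔ to′ from′
    where
    to′ : Member (Exc permutationOf) x → Member A x
    to′ (i , i<fi , l , h) = subst (Member A)
      (interval-≡ (trans lo-y (sym l)) (trans (on-start i y∈A lo-y) (sym h))) y∈A
      where
      starts : ∃ λ y → Member A y × lo y ≡ suc (toℕ i)
      starts = decidable-stable (startAt? A (toℕ i)) λ ¬s →
        ℕ.<⇒≱ i<fi (non-start i (dec-false (startAt? A (toℕ i)) ¬s))
      y∈A  = proj₁ (proj₂ starts)
      lo-y = proj₂ (proj₂ starts)
    from′ : Member A x → Member (Exc permutationOf) x
    from′ x∈A = i , subst₂ _≤_ l h′ (lo≤hi x) , l , h′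
      where
      p = proj₁ (lo≡suc x)
      e : lo x ≡ suc p
      e = proj₂ (lo≡suc x)
      p<n : p < n
      p<n = ℕ.≤-trans (subst (_≤ hi x) e (lo≤hi x)) (ℕ.≤-trans (hi≤m x) (ℕ.m∸n≤m n 1))
      i = fromℕ< p<n
      l : lo x ≡ suc (toℕ i)
      l = trans e (cong suc (sym (Fin.toℕ-fromℕ< p<n)))
      h′ = on-start i x∈A l

-- Conversely, every 321-avoiding permutation is the matching of its colourings.
module ToAntichain {n} (π : S321 n) where

  private
    A = Exc π
    f : Fin n → Fin n
    f = perm π ⟨$⟩ʳ_

    f-injective : ∀ {i j} → toℕ (f i) ≡ toℕ (f j) → i ≡ j
    f-injective e = ⟨$⟩ʳ-injective (perm π) (Fin.toℕ-injective e)

    start⇒ : ∀ i → start A (toℕ i) ≡ true → i Fin.< f i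
    start⇒ i s with x , (j , j<fj , l , _) , e ← does-true (startAt? A (toℕ i)) s
      with refl ← Fin.toℕ-injective (ℕ.suc-injective (trans (sym e) l)) = j<fj

    exc : ∀ i → i Fin.< f i → ∃ λ x → Member A x × lo x ≡ suc (toℕ i) × hi x ≡ toℕ (f i)
    exc i i<fi = [ suc (toℕ i) , toℕ (f i) ]⟨ s≤s z≤n , i<fi , ℕ.<⇒≤pred (Fin.toℕ<n (f i)) ⟩
      , (i , i<fi , refl , refl) , refl , refl

    start⇐ : ∀ i → i Fin.< f i → start A (toℕ i) ≡ true
    start⇐ i i<fi with x , x∈A , l , _ ← exc i i<fi = dec-true (startAt? A _) (x , x∈A , l)

    end⇐ : ∀ i → i Fin.< f i → end A (toℕ (f i)) ≡ true
    end⇐ i i<fi with x , x∈A , _ , h ← exc i i<fi = dec-true (endAt? A _) (x , x∈A , h)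

    end⇒ : ∀ i → end A (toℕ (f i)) ≡ true → i Fin.< f i
    end⇒ i s with x , (j , j<fj , _ , h) , e ← does-true (endAt? A (toℕ (f i))) s
      with refl ← f-injective (trans (sym e) h) = j<fj

    colour : ∀ i → end A (toℕ (f i)) ≡ start A (toℕ i)
    colour i with i Fin.<? f i
    ... | yes lt = trans (end⇐ i lt) (sym (start⇐ i lt))
    ... | no ≮   = trans (Bool.¬-not (≮ ∘ end⇒ i)) (sym (Bool.¬-not (≮ ∘ start⇒ i)))

    increasing : ∀ {i j} → start A (toℕ i) ≡ start A (toℕ j) → i Fin.< j → f i Fin.< f j
    increasing {i} {j} e i<j with j Fin.<? f j
    ... | yes j<fj = exceedances-increase π i<j j<fj
    ... | no j≮fj  = non-exceedances-increase π i<j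
      (ℕ.≮⇒≥ λ i<fi → j≮fj (start⇒ j (trans (sym e) (start⇐ i i<fi))))

    reflecting : ∀ {i j} → start A (toℕ i) ≡ start A (toℕ j) → f i Fin.< f j → i Fin.< j
    reflecting {i} {j} e fi<fj with ℕ.<-cmp (toℕ i) (toℕ j)
    ... | tri< lt _ _ = lt
    ... | tri≈ _ p _  = contradiction fi<fj (ℕ.<-irrefl (cong (toℕ ∘ f) (Fin.toℕ-injective p)))
    ... | tri> _ _ gt = contradiction (increasing (sym e) gt) (ℕ.<-asym fi<fj)

    module _ (b : Bool) where

      Cut : ℕ → ℕ → Set
      Cut p q = ∃ λ i → p ≡ toℕ i × q ≡ toℕ (f i) × start A (toℕ i) ≡ b

      forth : ∀ {p q} → Cut p q → ∀ {p′} → p′ < p → start A p′ ≡ b →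
        ∃ λ q′ → q′ < q × end A q′ ≡ b × Cut p′ q′
      forth (i , refl , refl , s) {p′} p′<i s′ with p′<n ← ℕ.<-trans p′<i (Fin.toℕ<n i)
        with j ← fromℕ< p′<n in ej
        with refl ← trans (sym (Fin.toℕ-fromℕ< p′<n)) (cong toℕ ej) =
        toℕ (f j) , increasing (trans s′ (sym s)) p′<i , trans (colour j) s′ ,
        (j , refl , refl , s′)

      back : ∀ {q p} → Cut p q → ∀ {q′} → q′ < q → end A q′ ≡ b →
        ∃ λ p′ → p′ < p × start A p′ ≡ b × Cut p′ q′
      back (i , refl , refl , s) {q′} q′<q s′ = toℕ j
        , reflecting (trans sj (sym s)) (subst (_< toℕ (f i)) q′≡ q′<q)
        , sj , (j , refl , q′≡ , sj)
        where
        q′<n = ℕ.<-trans q′<q (Fin.toℕ<n (f i))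
        j = perm π ⟨$⟩ˡ fromℕ< q′<n
        q′≡ : q′ ≡ toℕ (f j)
        q′≡ = trans (sym (Fin.toℕ-fromℕ< q′<n)) (cong toℕ (sym (inverseʳ (perm π))))
        sj : start A (toℕ j) ≡ b
        sj = trans (sym (colour j)) (trans (cong (end A) (sym q′≡)) s′)

  π-Match : ∀ i → Match (start A) (end A) (toℕ i) (toℕ (f i))
  π-Match i = colour i , trans (cong (λ b → rank (end A) b (toℕ (f i))) (colour i))
    (ℕ.≤-antisym
      (rank-simulation (end A) (start A) b (λ q p → Cut b p q) (back b) cut)
      (rank-simulation (start A) (end A) b (Cut b) (forth b) cut))
    where
    b = start A (toℕ i)
    cut : Cut b (toℕ i) (toℕ (f i))
    cut = i , refl , refl , refl

module _ {m} {A B : Antichain m} (A≈B : ∀ x → Member A x ⇔ Member B x) where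

  private
    does-cong : ∀ {P Q : Set} (P? : Dec P) (Q? : Dec Q) → (P → Q) → (Q → P) →
      does P? ≡ does Q?
    does-cong (yes _) (yes _) _ _ = refl
    does-cong (yes p) (no ¬q) f _ = contradiction (f p) ¬q
    does-cong (no ¬p) (yes q) _ g = contradiction (g q) ¬p
    does-cong (no _)  (no _)  _ _ = refl

  start-cong : ∀ k → start A k ≡ start B k
  start-cong k = does-cong (startAt? A k) (startAt? B k)
    (λ (x , x∈ , e) → x , Equivalence.to (A≈B x) x∈ , e)
    (λ (x , x∈ , e) → x , Equivalence.from (A≈B x) x∈ , e)

  end-cong : ∀ k → end A k ≡ end B k
  end-cong k = does-cong (endAt? A k) (endAt? B k)
    (λ (x , x∈ , e) → x , Equivalence.to (A≈B x) x∈ , e)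
    (λ (x , x∈ , e) → x , Equivalence.from (A≈B x) x∈ , e)

  Match-cong : ∀ {p q} → Match (start A) (end A) p q → Match (start B) (end B) p q
  Match-cong {p} {q} (e , r) =
    trans (sym (end-cong q)) (trans e (start-cong p)) ,
    trans (trans (cong (λ b → rank (end B) b q) (sym (end-cong q)))
                 (sym (rank-cong _ end-cong q)))
          (trans r (trans (rank-cong _ start-cong p)
                          (cong (λ b → rank (start B) b p) (start-cong p))))

module _ {n : ℕ} where

  open Setoid (S321-setoid n) using () renaming (_≈_ to _≈ˢ_)
  open Setoid (Antichain-setoid (n ∸ 1)) using ()
    renaming (_≈_ to _≈ᴬ_; sym to symᴬ; trans to transᴬ)

  Exc-cong : ∀ {π σ : S321 n} → π ≈ˢ σ → Exc π ≈ᴬ Exc σ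
  Exc-cong {π} {σ} e x = mk⇔ (go {π} {σ} e) (go {σ} {π} (λ i → sym (e i)))
    where
    go : ∀ {π σ : S321 n} → π ≈ˢ σ → Member (Exc π) x → Member (Exc σ) x
    go e (i , lt , l , h) =
      i , subst (i Fin.<_) (e i) lt , l , trans h (cong toℕ (e i))

  Exc-injective : ∀ {π σ : S321 n} → Exc π ≈ᴬ Exc σ → π ≈ˢ σ
  Exc-injective {π} {σ} e i = Fin.toℕ-injective
    (Match-unique {start (Exc σ)} {end (Exc σ)}
      (Match-cong {A = Exc π} {B = Exc σ} e (ToAntichain.π-Match π i))
      (ToAntichain.π-Match σ i))

  Exc-bijection : Bijection (S321-setoid n) (Antichain-setoid (n ∸ 1))
  Exc-bijection = record
    { to        = Exc
    ; cong      = λ {π} {σ} → Exc-cong {π} {σ}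
    ; bijective = (λ {π} {σ} → Exc-injective {π} {σ})
                , λ A → FromAntichain.permutationOf {n} A , λ {π} e →
                    transᴬ {Exc π} {Exc (FromAntichain.permutationOf {n} A)} {A}
                      (Exc-cong {π} {FromAntichain.permutationOf {n} A} e)
                      (FromAntichain.Exc-permutationOf {n} A)
    }

Exc⁻¹ : ∀ {n} → Antichain (n ∸ 1) → S321 n
Exc⁻¹ {n} = Inverse.from (Bijection⇒Inverse (Exc-bijection {n}))

ρ𝒮 : ∀ {n} → S321 n → S321 n
ρ𝒮 {n} π = Exc⁻¹ {n} (ρ𝒜 (Exc π))

module _ {c ℓ} (S : Setoid c ℓ) where
  open Setoid S using (_≈_) renaming (Carrier to X)
  open Membership S using (_∈_)
  open Unique S using (Unique)

  -- O lists, without repetition, the orbit of some x under f.  Nonnegative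
  -- powers of f suffice, as f will be a bijection of a finite set.
  IsOrbit : (X → X) → List⁺ X → Set (c ⊔ ℓ)
  IsOrbit f O = Unique (toList O) ×
    ∃ λ x → ∀ y → y ∈ toList O ⇔ (∃ λ k → y ≈ fold x f k)

  average : (X → ℕ) → List⁺ X → ℚ
  average stat O = (ℤ.+ ListAction.sum (toList (List⁺.map stat O))) / List⁺.length O

  IsMesic : ℚ → (X → X) → (X → ℕ) → Set (c ⊔ ℓ)
  IsMesic q f stat = ∀ O → IsOrbit f O → average stat O ≡ q

-- Orbits of an endofunction of a finite setoid exist, so that quantifying over
-- them is not vacuous.
module _ {c ℓ} (S : Setoid c ℓ) {N}
  (code : Setoid.Carrier S → Fin N)
  (code-cong : ∀ {x y} → Setoid._≈_ S x y → code x ≡ code y)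
  (code-injective : ∀ {x y} → code x ≡ code y → Setoid._≈_ S x y)
  (f : Setoid.Carrier S → Setoid.Carrier S)
  (f-cong : ∀ {x y} → Setoid._≈_ S x y → Setoid._≈_ S (f x) (f y)) where

  open Setoid S renaming (refl to ≈-refl; sym to ≈-sym; trans to ≈-trans)

  private
    _≈?_ : ∀ x y → Dec (x ≈ y)
    x ≈? y = map′ code-injective code-cong (code x Fin.≟ code y)

    S-dec : DecSetoid c ℓ
    S-dec = record { isDecEquivalence = record
      { isEquivalence = isEquivalence ; _≟_ = _≈?_ } }

    fold-cong : ∀ {x y} k → x ≈ y → fold x f k ≈ fold y f k
    fold-cong zero    e = e
    fold-cong (suc k) e = f-cong (fold-cong k e)

    module _ (x : Carrier) {a b} (a<b : a < b) (e : fold x f a ≈ fold x f b) where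

      reduce : ∀ k → Acc _<_ k → ∃ λ l → l < b × fold x f k ≈ fold x f l
      reduce k (acc rs) with k ℕ.<? b
      ... | yes k<b = k , k<b , ≈-refl
      ... | no k≮b  =
        let l , l<b , e′ = reduce (d + a) (rs smaller) in l , l<b , ≈-trans shift e′
        where
        d = k ∸ b
        k≡ : d + b ≡ k
        k≡ = ℕ.m∸n+n≡m (ℕ.≮⇒≥ k≮b)
        smaller : d + a < k
        smaller = subst (d + a <_) k≡ (ℕ.+-monoʳ-< d a<b)
        shift : fold x f k ≈ fold x f (d + a)
        shift = ≈-trans (reflexive (trans (cong (fold x f) (sym k≡)) (fold-+ x f d)))
          (≈-trans (fold-cong d (≈-sym e)) (reflexive (sym (fold-+ x f d))))

  orbit-exists : ∀ x → ∃ λ O → IsOrbit S f O × Membership._∈_ S x (toList O)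
  orbit-exists x with Fin.pigeonhole (ℕ.n<1+n N) (λ k → code (fold x f (toℕ k)))
  ... | a , b@(suc _) , a<b , e = O , (unique , x , λ y → mk⇔ (to′ y) (from′ y)) , from′ x (0 , ≈-refl)
    where
    open Membership S using (_∈_)
    powers = applyUpTo (fold x f) (toℕ b)
    O : List⁺ Carrier
    O = x List⁺.∷ drop 1 (deduplicate _≈?_ powers)
    unique = deduplicate-! S-dec powers
    to′ : ∀ y → y ∈ toList O → ∃ λ k → y ≈ fold x f k
    to′ y y∈ with k , _ , e′ ← ∈-applyUpTo⁻ S (fold x f) (∈-deduplicate⁻ S _≈?_ powers y∈) =
      k , e′
    from′ : ∀ y → (∃ λ k → y ≈ fold x f k) → y ∈ toList O
    from′ y (k , e′)
      with l , l<b , e″ ← reduce x a<b (code-injective e) k (<-wellFounded k) =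
      ∈-deduplicate⁺ S _≈?_ (λ p q → ≈-trans q (≈-sym p))
        (∈-resp-≈ S (≈-sym (≈-trans e′ e″)) (∈-applyUpTo⁺ S (fold x f) l<b))

module _ {n : ℕ} where

  ρ𝒜-cong : ∀ {m} {A B : Antichain m} → Setoid._≈_ (Antichain-setoid m) A B →
    Setoid._≈_ (Antichain-setoid m) (ρ𝒜 A) (ρ𝒜 B)
  ρ𝒜-cong {m} {A} {B} e x = mk⇔ (go {A} {B} e) (go {B} {A} (λ y → Sym.⇔-sym (e y)))
    where
    go : ∀ {A B : Antichain m} → Setoid._≈_ (Antichain-setoid m) A B →
      Member (ρ𝒜 A) x → Member (ρ𝒜 B) x
    go e (x∉ , x-min) =
      (λ (y , y∈ , x⊆y) → x∉ (y , Equivalence.from (e y) y∈ , x⊆y)) ,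
      λ z z∉ → x-min z (λ (y , y∈ , z⊆y) → z∉ (y , Equivalence.to (e y) y∈ , z⊆y))

  ρ𝒮-cong : ∀ {π σ : S321 n} → perm π Perm.≈ perm σ → perm (ρ𝒮 π) Perm.≈ perm (ρ𝒮 σ)
  ρ𝒮-cong {π} {σ} e = Inverse.from-cong (Bijection⇒Inverse (Exc-bijection {n}))
    {ρ𝒜 (Exc π)} {ρ𝒜 (Exc σ)} (ρ𝒜-cong {A = Exc π} {Exc σ} (Exc-cong {n} {π} {σ} e))

  funToFin-cong : ∀ {m} {f g : Fin m → Fin n} → (∀ i → f i ≡ g i) →
    Fin.funToFin f ≡ Fin.funToFin g
  funToFin-cong {zero}  e = refl
  funToFin-cong {suc m} e = cong₂ Fin.combine (e zero) (funToFin-cong (e ∘ suc))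

  ρ𝒮-orbit-exists : ∀ π → ∃ λ O → IsOrbit (S321-setoid n) ρ𝒮 O ×
    Membership._∈_ (S321-setoid n) π (toList O)
  ρ𝒮-orbit-exists = orbit-exists (S321-setoid n)
    (λ π → Fin.funToFin (perm π ⟨$⟩ʳ_))
    funToFin-cong
    (λ {π} {σ} e i → trans (sym (Fin.finToFun-funToFin (perm π ⟨$⟩ʳ_) i))
      (trans (cong (λ k → Fin.finToFun k i) e) (Fin.finToFun-funToFin (perm σ ⟨$⟩ʳ_) i)))
    ρ𝒮 (λ {π} {σ} → ρ𝒮-cong {π} {σ})

-- The shift to 0-based positions and values does not affect the comparisons.
ℓ : ∀ {n} → Fin n → S321 n → ℕ
ℓ i π = χ ((perm π ⟨$⟩ˡ i) Fin.≤? i) + χ (i Fin.<? (perm π ⟨$⟩ʳ i))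

{-# OPTIONS --safe #-}
-- For a permutation π write u, e, d, w at i for the truth values of π⁻¹(i) ≤ i,
-- π(i) > i, π⁻¹(i) < i and π(i) ≥ i; then u + e = d + w, as both u - d and w - e
-- detect the fixed point i.  The minimal elements outside the ideal of the
-- exceedances of π are read off from consecutive weak exceedances of π: the
-- rowmotion image σ of π has an exceedance at position i iff π has a weak one at
-- position i + 1, and an exceedance with value i + 1 iff π has a weak one with
-- value i.  So e(σ) at i is w(π) at i + 1 and d(σ) at i + 1 is u(π) at i.  Sums over
-- an orbit do not change under rowmotion, hence those of u + e = d + w do not
-- depend on i, and at i = 1 we have d = 0 and w = 1.
module Submission where

open import Defs
open import Data.Bool.Base using (if_then_else_)
open import Data.Fin.Base as Fin using (Fin; zero; suc; toℕ; inject₁)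
open import Data.Fin.Induction using (<-weakInduction)
open import Data.Fin.Permutation
  using (_⟨$⟩ʳ_; _⟨$⟩ˡ_; inverseˡ; inverseʳ; _∘ₚ_; transpose)
import Data.Fin.Permutation as Perm
import Data.Fin.Permutation.Components as PC
import Data.Fin.Properties as Fin
import Data.Integer.Base as ℤ
import Data.Integer.Properties as ℤ
open import Data.List.Base using (List; []; _∷_; _++_; length; map)
import Data.List.Membership.Setoid as Membership
import Data.List.Membership.Setoid.Properties as Membershipₚ
open import Data.List.NonEmpty.Base as List⁺ using (toList)
import Data.List.Properties as List
import Data.List.Relation.Binary.Permutation.Setoid as Permutation
import Data.List.Relation.Binary.Permutation.Setoid.Properties as Permutationₚ
import Data.List.Relation.Unary.All as All
open import Data.List.Relation.Unary.AllPairs using ([]; _∷_)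
open import Data.List.Relation.Unary.Any using (here; there)
import Data.List.Relation.Unary.Unique.Setoid as Unique
import Data.List.Relation.Unary.Unique.Setoid.Properties as Uniqueₚ
open import Data.Nat.Base using (ℕ; zero; suc; _+_; _∸_; _≤_; _<_; z≤n; s≤s)
open import Data.Nat.Induction using (<-wellFounded; Acc; acc)
import Data.Nat.ListAction as ListAction
import Data.Nat.Properties as ℕ
open import Algebra.Properties.CommutativeSemigroup ℕ.+-commutativeSemigroup using (interchange)
open import Data.Product.Base using (∃; _×_; _,_; proj₁; proj₂)
open import Data.Rational.Base using (1ℚ; _/_)
import Data.Rational.Properties as ℚ
open import Data.Rational.Unnormalised.Base using (mkℚᵘ; *≡*; 1ℚᵘ)
open import Data.Sum.Base using (inj₁; inj₂)
open import Function.Base using (_∘_)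
open import Function.Bundles using (_⇔_; mk⇔; module Equivalence; Inverse)
import Function.Construct.Symmetry as Sym
open import Function.Properties.Bijection using (Bijection⇒Inverse)
open import Relation.Binary.Bundles using (Setoid; module Poset)
open import Relation.Binary.Definitions using (tri<; tri≈; tri>)
open import Relation.Binary.PropositionalEquality as ≡
  using (_≡_; _≢_; refl; sym; trans; cong; cong₂; subst; subst₂)
open import Relation.Nullary using (¬_; Dec; yes; no; contradiction; ¬?; _×-dec_)
open import Relation.Nullary.Decidable using (dec-true; dec-false; decidable-stable; does-⇔)

open Equivalence using (to; from)

-- Invariance of orbit sums under an injective map.

module _ {a ℓ} (S : Setoid a ℓ) where
  open Setoid S renaming (Carrier to X; refl to ≈-refl; sym to ≈-sym; trans to ≈-trans)
  open Membership S using (_∈_)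
  open Unique S using (Unique)
  open Permutation S using (_↭_; ↭-refl; ↭-sym; ↭-trans; ↭-prep; ↭-reflexive-≋)
  open Permutationₚ S using (shift; ∈-resp-↭; xs↭ys⇒|xs|≡|ys|)

  -- Induction on `xs`: its head occurs in `ys` and is moved to the front. As the head does not
  -- recur in `xs`, the tail stays inside what is left of `ys`, and the length bound ensures that
  -- nothing of `ys` remains at the end.
  unique∧⊆⇒↭ : ∀ {xs ys} → Unique xs → (∀ {z} → z ∈ xs → z ∈ ys) →
    length ys ≤ length xs → xs ↭ ys
  unique∧⊆⇒↭ {[]}     {[]}    _          _     _ = ↭-refl
  unique∧⊆⇒↭ {x ∷ xs} {ys} (x∉xs ∷ xs!) xs⊆ys |ys|≤
    with ys₁ , ys₂ , w , x≈w , ys≋ ← Membershipₚ.∈-∃++ S (xs⊆ys (here ≈-refl)) =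
    ↭-trans (↭-prep x (unique∧⊆⇒↭ xs! rest
      (ℕ.≤-pred (ℕ.≤-trans (ℕ.≤-reflexive (sym (xs↭ys⇒|xs|≡|ys| split))) |ys|≤)))) (↭-sym split)
    where
    split : ys ↭ x ∷ ys₁ ++ ys₂
    split = ↭-trans (↭-reflexive-≋ ys≋) (shift (≈-sym x≈w) ys₁ ys₂)
    rest : ∀ {z} → z ∈ xs → z ∈ ys₁ ++ ys₂
    rest z∈xs with ∈-resp-↭ split (xs⊆ys (there z∈xs))
    ... | here z≈x = contradiction (≈-sym z≈x)
      (All.lookupₛ S (λ e ¬p q → ¬p (≈-trans q (≈-sym e))) x∉xs z∈xs)
    ... | there z∈ = z∈

  module _ {f : X → X} (f-cong : ∀ {x y} → x ≈ y → f x ≈ f y)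
    (f-injective : ∀ {x y} → f x ≈ f y → x ≈ y) where

    -- The list `map f (toList O)` has no repetitions by injectivity, stays inside the orbit and has
    -- the same length, so it is a rearrangement of the orbit.
    orbit-sum-invariant : ∀ {O} → IsOrbit S f O → (s : X → ℕ) → (∀ {x y} → x ≈ y → s x ≡ s y) →
      ListAction.sum (map (s ∘ f) (toList O)) ≡ ListAction.sum (map s (toList O))
    orbit-sum-invariant {O} (O! , x , O⇔) s s-cong = trans
      (cong ListAction.sum (List.map-∘ {g = s} {f = f} (toList O)))
      (Permutationₚ.foldr-commMonoid (≡.setoid ℕ) ℕ.+-0-isCommutativeMonoid
        (Permutationₚ.map⁺ S (≡.setoid ℕ) s-cong fO↭O))
      where
      closed : ∀ {z} → z ∈ map f (toList O) → z ∈ toList O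
      closed z∈ with y , y∈O , z≈fy ← Membershipₚ.∈-map⁻ S S z∈
        with k , y≈ ← to (O⇔ y) y∈O = from (O⇔ _) (suc k , ≈-trans z≈fy (f-cong y≈))
      fO↭O : map f (toList O) ↭ toList O
      fO↭O = unique∧⊆⇒↭ (Uniqueₚ.map⁺ S S f-injective O!) closed
        (ℕ.≤-reflexive (sym (List.length-map f (toList O))))

sum-map-+ : ∀ {a} {X : Set a} (s t : X → ℕ) xs →
  ListAction.sum (map (λ x → s x + t x) xs) ≡ ListAction.sum (map s xs) + ListAction.sum (map t xs)
sum-map-+ s t []       = refl
sum-map-+ s t (x ∷ xs) = trans (cong (s x + t x +_) (sum-map-+ s t xs)) (interchange (s x) (t x) _ _)

sum-map-1 : ∀ {a} {X : Set a} (xs : List X) → ListAction.sum (map (λ _ → 1) xs) ≡ length xs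
sum-map-1 []       = refl
sum-map-1 (x ∷ xs) = cong suc (sum-map-1 xs)

n/n≡1ℚ : ∀ n → (ℤ.+ suc n) / suc n ≡ 1ℚ
n/n≡1ℚ n = ℚ.fromℚᵘ-cong {mkℚᵘ (ℤ.+ suc n) n} {1ℚᵘ} (*≡* (ℤ.*-comm (ℤ.+ suc n) (ℤ.+ 1)))

-- Injectivity of rowmotion on antichains and on permutations.

module _ {m} (A : Antichain m) where

  Ideal : Interval m → Set
  Ideal = IdealGeneratedBy (𝐀 m) (Member A)

  ideal? : ∀ x → Dec (Ideal x)
  ideal? x = anyInterval? λ y → member? A y ×-dec (x ⊆? y)

  -- Descent on `hi x ∸ lo x`: for an interval strictly inside `x` either the lower end rises or,
  -- the lower ends being equal, the upper end drops.
  minimal-below : ∀ x → ¬ Ideal x → ∃ λ y → Member (ρ𝒜 A) y × y ⊆ x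
  minimal-below x = go x (<-wellFounded _)
    where
    go : ∀ x → Acc _<_ (hi x ∸ lo x) → ¬ Ideal x → ∃ λ y → Member (ρ𝒜 A) y × y ⊆ x
    go x (acc rs) x∉ with anyInterval? (λ y → ¬? (ideal? y) ×-dec ((y ⊆? x) ×-dec ¬? (y ≟ᴵ x)))
    ... | no ¬∃ = x , (x∉ , λ y y∉ y⊆x → decidable-stable (y ≟ᴵ x) λ y≢x → ¬∃ (y , y∉ , y⊆x , y≢x))
        , ℕ.≤-refl , ℕ.≤-refl
    ... | yes (y , y∉ , (lo≤ , hi≤) , y≢x) =
      let z , z∈ , lo≤′ , hi≤′ = go y (rs smaller) y∉
      in z , z∈ , ℕ.≤-trans lo≤ lo≤′ , ℕ.≤-trans hi≤′ hi≤
      where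
      smaller : hi y ∸ lo y < hi x ∸ lo x
      smaller with ℕ.m≤n⇒m<n∨m≡n lo≤
      ... | inj₁ lo< = ℕ.≤-<-trans (ℕ.∸-monoˡ-≤ (lo y) hi≤)
                         (ℕ.∸-monoʳ-< lo< (ℕ.≤-trans (lo≤hi y) hi≤))
      ... | inj₂ lo≡ = subst (λ l → hi y ∸ lo y < hi x ∸ l) (sym lo≡)
                         (ℕ.∸-monoˡ-< (ℕ.≤∧≢⇒< hi≤ (λ hi≡ → y≢x (interval-≡ (sym lo≡) hi≡))) (lo≤hi y))

-- An order ideal is determined by the minimal elements of its complement, and an
-- antichain by the order ideal that it generates.
ρ𝒜-injective : ∀ {m} {A B : Antichain m} → Setoid._≈_ (Antichain-setoid m) (ρ𝒜 A) (ρ𝒜 B) →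
  Setoid._≈_ (Antichain-setoid m) A B
ρ𝒜-injective {m} {A} {B} e x = mk⇔ (members {A} {B} e) (members {B} {A} (Sym.⇔-sym ∘ e))
  where
  ideals : ∀ {A B : Antichain m} → Setoid._≈_ (Antichain-setoid m) (ρ𝒜 A) (ρ𝒜 B) →
    ∀ x → Ideal A x → Ideal B x
  ideals {A} {B} e x (y , y∈A , lo≤ , hi≤) = decidable-stable (ideal? B x) λ x∉ →
    let z , z∈ , lo≤′ , hi≤′ = minimal-below B x x∉
    in proj₁ (from (e z) z∈) (y , y∈A , ℕ.≤-trans lo≤ lo≤′ , ℕ.≤-trans hi≤′ hi≤)
  members : ∀ {A B : Antichain m} → Setoid._≈_ (Antichain-setoid m) (ρ𝒜 A) (ρ𝒜 B) →
    ∀ {x} → Member A x → Member B x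
  members {A} {B} e {x} x∈A
    with y , y∈B , x⊆y@(lo≤ , hi≤) ← ideals {A} {B} e x (x , x∈A , ℕ.≤-refl , ℕ.≤-refl)
    with z , z∈A , (lo≤′ , hi≤′) ← ideals {B} {A} (Sym.⇔-sym ∘ e) y (y , y∈B , ℕ.≤-refl , ℕ.≤-refl)
    with refl ← antichain A x∈A z∈A (ℕ.≤-trans lo≤′ lo≤ , ℕ.≤-trans hi≤ hi≤′) =
    subst (Member B) (Poset.antisym (𝐀 m) (lo≤′ , hi≤′) x⊆y) y∈B

Exc-ρ𝒮 : ∀ {n} (π : S321 n) x → Member (Exc (ρ𝒮 π)) x ⇔ Member (ρ𝒜 (Exc π)) x
Exc-ρ𝒮 {n} π = Inverse.strictlyInverseˡ (Bijection⇒Inverse (Exc-bijection {n})) (ρ𝒜 (Exc π))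

ρ𝒮-injective : ∀ {n} {π σ : S321 n} → perm (ρ𝒮 π) Perm.≈ perm (ρ𝒮 σ) → perm π Perm.≈ perm σ
ρ𝒮-injective {n} {π} {σ} e = Exc-injective {n} {π} {σ} (ρ𝒜-injective {A = Exc π} {Exc σ}
  λ x → mk⇔
    (to (Exc-ρ𝒮 σ x) ∘ to (Exc-cong {n} {ρ𝒮 π} {ρ𝒮 σ} e x) ∘ from (Exc-ρ𝒮 π x))
    (to (Exc-ρ𝒮 π x) ∘ from (Exc-cong {n} {ρ𝒮 π} {ρ𝒮 σ} e x) ∘ from (Exc-ρ𝒮 σ x)))

-- Weak exceedances and the order ideal of the exceedances.

module _ {n} (π : S321 n) where

  private
    f : Fin n → Fin n
    f = perm π ⟨$⟩ʳ_

    A = Exc π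

  -- Otherwise f j < f i, and by 321-avoidance the positions of the values
  -- 0, …, j - 1 and f i are all less than j.
  weak-exceedances-increase : ∀ {i j} → i Fin.< j → j Fin.≤ f j → f i Fin.< f j
  weak-exceedances-increase {i} {j} i<j j≤fj with ℕ.<-cmp (toℕ (f i)) (toℕ (f j))
  ... | tri< lt _ _ = lt
  ... | tri≈ _ e _  = contradiction i<j
    (ℕ.<-irrefl (cong toℕ (⟨$⟩ʳ-injective (perm π) (Fin.toℕ-injective e))))
  ... | tri> _ _ fj<fi = contradiction
    -- The transposition puts the value `f i` in the place of `j`, which turns these j + 1 values
    -- into an initial segment; it cannot fit into j positions.
    (initial-segment-≤ (transpose j (f i) ∘ₚ Perm.flip (perm π)) (Fin.toℕ<n j) below) ℕ.1+n≰n
    where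
    below : ∀ v → toℕ v < suc (toℕ j) → (perm π ⟨$⟩ˡ PC.transpose j (f i) v) Fin.< j
    below v (s≤s v≤j) with v Fin.≟ j
    ... | yes _ = subst (Fin._< j) (sym (inverseˡ (perm π))) i<j
    ... | no v≢j with v Fin.≟ f i
    ...   | yes refl = contradiction (ℕ.≤-trans v≤j j≤fj) (ℕ.<⇒≱ fj<fi)
    ...   | no _ = ℕ.≤∧≢⇒<
      (ℕ.≮⇒≥ λ j<k → avoids π i<j j<k (fj<fi , subst (Fin._< f j) (sym (inverseʳ (perm π))) v<fj))
      (λ k≡j → ℕ.<-irrefl
        (cong toℕ (trans (sym (inverseʳ (perm π))) (cong f (Fin.toℕ-injective k≡j)))) v<fj)
      where
      v<fj : v Fin.< f j
      v<fj = ℕ.<-≤-trans (ℕ.≤∧≢⇒< v≤j (v≢j ∘ Fin.toℕ-injective)) j≤fj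

  exceedance∈ideal : ∀ {j} (x : Interval (n ∸ 1)) → j Fin.< f j → suc (toℕ j) ≤ lo x →
    hi x ≤ toℕ (f j) → Ideal A x
  exceedance∈ideal {j} x j<fj lo≤ ≤hi =
    [ suc (toℕ j) , toℕ (f j) ]⟨ s≤s z≤n , j<fj , ℕ.<⇒≤pred (Fin.toℕ<n (f j)) ⟩
    , (j , j<fj , refl , refl) , lo≤ , ≤hi

  ideal⇒exceedance : ∀ (x : Interval (n ∸ 1)) → Ideal A x →
    ∃ λ j → j Fin.< f j × suc (toℕ j) ≤ lo x × hi x ≤ toℕ (f j)
  ideal⇒exceedance x (y , (j , j<fj , l , h) , lo≤ , hi≤) =
    j , j<fj , subst (_≤ lo x) l lo≤ , subst (hi x ≤_) h hi≤

  -- x strictly contains the interval [p + 1, f p] of a weak exceedance, which is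
  -- empty for a fixed point.
  beyond-weak-exceedance∉ideal : ∀ {p} (x : Interval (n ∸ 1)) → p Fin.≤ f p →
    lo x ≤ suc (toℕ p) → toℕ (f p) ≤ hi x → (suc (toℕ p) ≤ lo x → hi x ≢ toℕ (f p)) →
    ¬ Ideal A x
  beyond-weak-exceedance∉ideal {p} x p≤fp lo≤ ≤hi strict x∈
    with j , j<fj , lo≥ , hi≤ ← ideal⇒exceedance x x∈
    with ℕ.m≤n⇒m<n∨m≡n (ℕ.≤-pred (ℕ.≤-trans lo≥ lo≤))
  ... | inj₁ j<p = ℕ.<⇒≱ (weak-exceedances-increase j<p p≤fp) (ℕ.≤-trans ≤hi hi≤)
  ... | inj₂ j≡p with refl ← Fin.toℕ-injective j≡p = strict lo≥ (ℕ.≤-antisym hi≤ ≤hi)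

  -- Intervals are nonempty, so fitting inside [p + 1, f p] forces `p` to be a strict exceedance.
  within-weak-exceedance∈ideal : ∀ {p} (x : Interval (n ∸ 1)) →
    suc (toℕ p) ≤ lo x → hi x ≤ toℕ (f p) → Ideal A x
  within-weak-exceedance∈ideal x lo≥ hi≤ =
    exceedance∈ideal x (ℕ.≤-trans lo≥ (ℕ.≤-trans (lo≤hi x) hi≤)) lo≥ hi≤

-- Positions and values of the exceedances of the rowmotion image.

module _ {n} (π σ : S321 n)
  (Exc-σ : ∀ x → Member (Exc σ) x ⇔ Member (ρ𝒜 (Exc π)) x) where

  private
    f : Fin n → Fin n
    f = perm π ⟨$⟩ʳ_

    f⁻¹ : Fin n → Fin n
    f⁻¹ = perm π ⟨$⟩ˡ_

    g : Fin n → Fin n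
    g = perm σ ⟨$⟩ʳ_

    g⁻¹ : Fin n → Fin n
    g⁻¹ = perm σ ⟨$⟩ˡ_

    A = Exc π

  exceedance-position : ∀ {p q} → toℕ p ≡ suc (toℕ q) → q Fin.< g q ⇔ p Fin.≤ f p
  exceedance-position {p} {q} p≡1+q = mk⇔ to′ from′
    where
    to′ : q Fin.< g q → p Fin.≤ f p
    to′ q<gq = ℕ.≮⇒≥ λ fp<p → absurd fp<p (ℕ.m≤n⇒m<n∨m≡n q<gq)
      where
      x : Interval (n ∸ 1)
      x = [ suc (toℕ q) , toℕ (g q) ]⟨ s≤s z≤n , q<gq , ℕ.<⇒≤pred (Fin.toℕ<n (g q)) ⟩
      x∈ρA = to (Exc-σ x) (q , q<gq , refl , refl)
      absurd : f p Fin.< p → _ → _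
      absurd fp<p (inj₁ 1+q<gq) = ℕ.1+n≢n (cong lo (proj₂ x∈ρA z z∉ (ℕ.n≤1+n _ , ℕ.≤-refl)))
        where
        z : Interval (n ∸ 1)
        z = [ suc (suc (toℕ q)) , toℕ (g q) ]⟨ s≤s z≤n , 1+q<gq , hi≤m x ⟩
        -- An exceedance of `π` whose interval contains `z` but not `x` would have to be at `p`,
        -- where `f p` is less than `p`. So `z` contradicts the minimality of `x`.
        z∉ : ¬ Ideal A z
        z∉ z∈ with j , j<fj , s≤s j≤ , ≤fj ← ideal⇒exceedance π z z∈
          with ℕ.m≤n⇒m<n∨m≡n j≤
        ... | inj₁ j≤q = proj₁ x∈ρA (exceedance∈ideal π x j<fj j≤q ≤fj)
        ... | inj₂ j≡  with refl ← Fin.toℕ-injective (trans j≡ (sym p≡1+q)) = ℕ.<-asym fp<p j<fj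
      -- Now `x` is [p, p]. No exceedance interval contains it, so the p + 1 positions up to `p`
      -- would all take values among the p values below `p`.
      absurd fp<p (inj₂ 1+q≡gq) =
        ℕ.1+n≰n (initial-segment-≤ (perm π) (Fin.toℕ<n p) below)
        where
        below : ∀ k → toℕ k < suc (toℕ p) → f k Fin.< p
        below k (s≤s k≤p) with ℕ.m≤n⇒m<n∨m≡n k≤p
        ... | inj₂ k≡p = subst (λ k → f k Fin.< p) (sym (Fin.toℕ-injective k≡p)) fp<p
        ... | inj₁ k<p = ℕ.≰⇒> λ p≤fk → proj₁ x∈ρA
          (exceedance∈ideal π x (ℕ.<-≤-trans k<p p≤fk) (subst (toℕ k <_) p≡1+q k<p)
            (ℕ.≤-trans (ℕ.≤-reflexive (trans (sym 1+q≡gq) (sym p≡1+q))) p≤fk))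
    from′ : p Fin.≤ f p → q Fin.< g q
    from′ p≤fp =
      -- The interval [p, f p] extends that of `p` by one to the left. A minimal element below it
      -- starts at `p`, since otherwise it would fit inside [p + 1, f p]; in 1-based terms this is
      -- the interval of position `q` of `σ`.
      let y , y∈ρA , lo≥ , hi≤ = minimal-below A x (beyond-weak-exceedance∉ideal π x p≤fp
            (ℕ.n≤1+n _) ℕ.≤-refl λ 1+p≤p → contradiction 1+p≤p ℕ.1+n≰n)
          k , k<gk , l , _ = from (Exc-σ y) y∈ρA
      in subst (λ k → k Fin.< g k)
           (Fin.toℕ-injective (ℕ.suc-injective (trans (sym l) (trans (lo≡p y y∈ρA lo≥ hi≤) p≡1+q))))
           k<gk
      where
      x : Interval (n ∸ 1)
      x = [ toℕ p , toℕ (f p) ]⟨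
        subst (1 ≤_) (sym p≡1+q) (s≤s z≤n) , p≤fp , ℕ.<⇒≤pred (Fin.toℕ<n (f p)) ⟩
      lo≡p : ∀ y → Member (ρ𝒜 A) y → toℕ p ≤ lo y → hi y ≤ toℕ (f p) → lo y ≡ toℕ p
      lo≡p y y∈ρA lo≥ hi≤ = ℕ.≤-antisym
        (ℕ.≮⇒≥ λ p<lo → proj₁ y∈ρA (within-weak-exceedance∈ideal π y p<lo hi≤)) lo≥

  -- Mirror image of `exceedance-position`: intervals are shortened and extended at the right end
  -- instead of the left.
  exceedance-value : ∀ {v w} → toℕ w ≡ suc (toℕ v) → g⁻¹ w Fin.< w ⇔ f⁻¹ v Fin.≤ v
  exceedance-value {v} {w} w≡1+v = mk⇔ to′ from′
    where
    to′ : g⁻¹ w Fin.< w → f⁻¹ v Fin.≤ v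
    to′ q<w = ℕ.≮⇒≥ λ v<p → absurd v<p (ℕ.m≤n⇒m<n∨m≡n q<w)
      where
      q = g⁻¹ w
      gq≡w : g q ≡ w
      gq≡w = inverseʳ (perm σ)
      x : Interval (n ∸ 1)
      x = [ suc (toℕ q) , toℕ w ]⟨ s≤s z≤n , q<w , ℕ.<⇒≤pred (Fin.toℕ<n w) ⟩
      x∈ρA = to (Exc-σ x) (q , subst (q Fin.<_) (sym gq≡w) q<w , refl , cong toℕ (sym gq≡w))
      fj≢v : v Fin.< f⁻¹ v → ∀ {j} → j Fin.≤ v → f j ≢ v
      fj≢v v<p j≤v refl = ℕ.<⇒≱ v<p (subst (Fin._≤ v) (sym (inverseˡ (perm π))) j≤v)
      absurd : v Fin.< f⁻¹ v → _ → _
      absurd v<p (inj₁ 1+q<w) = ℕ.1+n≢n (trans (sym w≡1+v)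
        (cong hi (sym (proj₂ x∈ρA z z∉ (ℕ.≤-refl , ℕ.≤-trans (ℕ.n≤1+n _) (ℕ.≤-reflexive (sym w≡1+v)))))))
        where
        1+q≤v = ℕ.≤-pred (subst (suc (suc (toℕ q)) ≤_) w≡1+v 1+q<w)
        z : Interval (n ∸ 1)
        z = [ suc (toℕ q) , toℕ v ]⟨ s≤s z≤n , 1+q≤v , ℕ.<⇒≤pred (Fin.toℕ<n v) ⟩
        -- An exceedance whose interval contains `z` has a value other than `v` by `fj≢v`, hence at
        -- least `w`, so its interval contains `x` as well.
        z∉ : ¬ Ideal A z
        z∉ z∈ with j , j<fj , j≤q , v≤fj ← ideal⇒exceedance π z z∈ =
          proj₁ x∈ρA (exceedance∈ideal π x j<fj j≤q (subst (_≤ toℕ (f j)) (sym w≡1+v)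
            (ℕ.≤∧≢⇒< v≤fj λ e → fj≢v v<p (ℕ.<⇒≤ (ℕ.≤-trans j≤q 1+q≤v)) (Fin.toℕ-injective (sym e)))))
      absurd v<p (inj₂ 1+q≡w) =
        ℕ.1+n≰n (initial-segment-≤ (perm π) (Fin.toℕ<n v) below)
        where
        below : ∀ k → toℕ k < suc (toℕ v) → f k Fin.< v
        below k (s≤s k≤v) = ℕ.≤∧≢⇒< (ℕ.≮⇒≥ λ v<fk → proj₁ x∈ρA
            (exceedance∈ideal π x (ℕ.≤-<-trans k≤v v<fk)
              (ℕ.≤-trans (s≤s k≤v) (ℕ.≤-reflexive (trans (sym w≡1+v) (sym 1+q≡w))))
              (subst (_≤ toℕ (f k)) (sym w≡1+v) v<fk)))
          (fj≢v v<p k≤v ∘ Fin.toℕ-injective)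
    from′ : f⁻¹ v Fin.≤ v → g⁻¹ w Fin.< w
    from′ p≤v =
      -- Since `f p` is `v`, the interval [p + 1, w] extends that of `p` by one to the right, and a
      -- minimal element below it must end at `w`.
      let y , y∈ρA , lo≥ , hi≤ = minimal-below A x (beyond-weak-exceedance∉ideal π x p≤fp ℕ.≤-refl
            (ℕ.<⇒≤ fp<w) λ _ e → ℕ.<-irrefl (sym e) fp<w)
          k , k<gk , _ , h = from (Exc-σ y) y∈ρA
          gk≡w = Fin.toℕ-injective (trans (sym h) (hi≡w y y∈ρA lo≥ hi≤))
      in subst₂ Fin._<_ (trans (sym (inverseˡ (perm σ))) (cong g⁻¹ gk≡w)) gk≡w k<gk
      where
      p = f⁻¹ v
      fp≡v : toℕ (f p) ≡ toℕ v
      fp≡v = cong toℕ (inverseʳ (perm π))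
      p≤fp : p Fin.≤ f p
      p≤fp = subst (toℕ p ≤_) (sym fp≡v) p≤v
      x : Interval (n ∸ 1)
      x = [ suc (toℕ p) , toℕ w ]⟨
        s≤s z≤n , subst (suc (toℕ p) ≤_) (sym w≡1+v) (s≤s p≤v) , ℕ.<⇒≤pred (Fin.toℕ<n w) ⟩
      fp<w : f p Fin.< w
      fp<w = ℕ.≤-reflexive (trans (cong suc fp≡v) (sym w≡1+v))
      hi≡w : ∀ y → Member (ρ𝒜 A) y → suc (toℕ p) ≤ lo y → hi y ≤ toℕ w → hi y ≡ toℕ w
      hi≡w y y∈ρA lo≥ hi≤ = ℕ.≤-antisym hi≤
        (ℕ.≮⇒≥ λ hi<w → proj₁ y∈ρA (within-weak-exceedance∈ideal π y lo≥
          (ℕ.≤-pred (ℕ.≤-trans hi<w (ℕ.≤-reflexive (trans w≡1+v (cong suc (sym fp≡v))))))))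

-- The indicator statistics and their orbit sums.

χ-cong : ∀ {p q} {P : Set p} {Q : Set q} → P ⇔ Q → (P? : Dec P) (Q? : Dec Q) → χ P? ≡ χ Q?
χ-cong P⇔Q P? Q? = cong (λ b → if b then 1 else 0) (does-⇔ P⇔Q P? Q?)

-- In this order, the truth values u, e, d and w at `i`.
weak-value exceedance value weak-exceedance : ∀ {n} → Fin n → S321 n → ℕ
weak-value      i π = χ ((perm π ⟨$⟩ˡ i) Fin.≤? i)
exceedance      i π = χ (i Fin.<? (perm π ⟨$⟩ʳ i))
value           i π = χ ((perm π ⟨$⟩ˡ i) Fin.<? i)
weak-exceedance i π = χ (i Fin.≤? (perm π ⟨$⟩ʳ i))

module _ {n} (i : Fin n) where

  -- Equality in the setoid compares forward maps only, so agreement of the inverses has to be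
  -- derived.
  value-cong : ∀ {π σ : S321 n} → perm π Perm.≈ perm σ → value i π ≡ value i σ
  value-cong {π} {σ} e = cong (λ j → χ (j Fin.<? i))
    (trans (sym (inverseˡ (perm σ))) (cong (perm σ ⟨$⟩ˡ_)
      (trans (sym (e (perm π ⟨$⟩ˡ i))) (inverseʳ (perm π)))))

  exceedance-cong : ∀ {π σ : S321 n} → perm π Perm.≈ perm σ → exceedance i π ≡ exceedance i σ
  exceedance-cong e = cong (λ j → χ (i Fin.<? j)) (e i)

  -- At a fixed point the sums are 1 + 0 and 0 + 1; elsewhere weak and strict comparisons agree term
  -- by term.
  ℓ-split : ∀ π → ℓ i π ≡ value i π + weak-exceedance i π
  ℓ-split π with (perm π ⟨$⟩ʳ i) Fin.≟ i
  ... | yes fi≡i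
    rewrite trans (cong (perm π ⟨$⟩ˡ_) (sym fi≡i)) (inverseˡ (perm π)) | fi≡i
          | dec-true (i Fin.≤? i) ℕ.≤-refl | dec-false (i Fin.<? i) (ℕ.<-irrefl refl) = refl
  ... | no fi≢i = cong₂ _+_
    (χ-cong (mk⇔ (λ ≤i → ℕ.≤∧≢⇒< ≤i λ e → fi≢i
        (trans (cong (perm π ⟨$⟩ʳ_) (sym (Fin.toℕ-injective e))) (inverseʳ (perm π)))) ℕ.<⇒≤)
      (_ Fin.≤? i) (_ Fin.<? i))
    (χ-cong (mk⇔ ℕ.<⇒≤ (λ i≤ → ℕ.≤∧≢⇒< i≤ (fi≢i ∘ sym ∘ Fin.toℕ-injective)))
      (i Fin.<? _) (i Fin.≤? _))

-- The map is a parameter because type checking is intractable when ρ𝒮 unfolds.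
module _ {m} (ρ : S321 (suc m) → S321 (suc m))
  (ρ-cong : ∀ {π σ} → perm π Perm.≈ perm σ → perm (ρ π) Perm.≈ perm (ρ σ))
  (ρ-injective : ∀ {π σ} → perm (ρ π) Perm.≈ perm (ρ σ) → perm π Perm.≈ perm σ)
  (Exc-ρ : ∀ π x → Member (Exc (ρ π)) x ⇔ Member (ρ𝒜 (Exc π)) x)
  {O} (orbit : IsOrbit (S321-setoid (suc m)) ρ O) where

  private
    Σ[_] : (S321 (suc m) → ℕ) → ℕ
    Σ[ s ] = ListAction.sum (map s (toList O))

    Σ-cong : ∀ {s t} → (∀ π → s π ≡ t π) → Σ[ s ] ≡ Σ[ t ]
    Σ-cong e = cong ListAction.sum (List.map-cong e (toList O))

    Σ-ρ : ∀ s → (∀ {π σ : S321 (suc m)} → perm π Perm.≈ perm σ → s π ≡ s σ) → Σ[ s ∘ ρ ] ≡ Σ[ s ]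
    Σ-ρ = orbit-sum-invariant (S321-setoid (suc m))
      (λ {π} {σ} → ρ-cong {π} {σ}) (λ {π} {σ} → ρ-injective {π} {σ}) orbit

  orbit-sum-ℓ : ∀ i → Σ[ ℓ i ] ≡ List⁺.length O
  orbit-sum-ℓ = <-weakInduction (λ i → Σ[ ℓ i ] ≡ List⁺.length O)
    -- At the first position d is 0 and w is 1 by computation, so the split statistic is the
    -- constant 1.
    (trans (Σ-cong (ℓ-split zero)) (sum-map-1 (toList O)))
    λ i ih → trans (step i) ih
    where
    open ≡.≡-Reasoning
    step : ∀ i → Σ[ ℓ (suc i) ] ≡ Σ[ ℓ (inject₁ i) ]
    step i = begin
      Σ[ ℓ (suc i) ]
        ≡⟨ Σ-cong (ℓ-split (suc i)) ⟩
      Σ[ (λ π → value (suc i) π + weak-exceedance (suc i) π) ]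
        ≡⟨ sum-map-+ (value (suc i)) (weak-exceedance (suc i)) (toList O) ⟩
      Σ[ value (suc i) ] + Σ[ weak-exceedance (suc i) ]
        -- Each term uses orbit invariance once and the pointwise shift once, in opposite orders: d
        -- is first composed with `ρ` and then becomes u at the previous index, while w first
        -- becomes e composed with `ρ` at the previous index and then loses `ρ`.
        ≡⟨ cong₂ _+_ (sym (Σ-ρ (value (suc i)) λ {π} {σ} → value-cong (suc i) {π} {σ}))
             (Σ-cong λ π → sym (χ-cong (exceedance-position π (ρ π) (Exc-ρ π) succ)
               (inject₁ i Fin.<? _) (suc i Fin.≤? _))) ⟩
      Σ[ value (suc i) ∘ ρ ] + Σ[ exceedance (inject₁ i) ∘ ρ ]
        ≡⟨ cong₂ _+_ (Σ-cong λ π → χ-cong (exceedance-value π (ρ π) (Exc-ρ π) succ)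
               (_ Fin.<? suc i) (_ Fin.≤? inject₁ i))
             (Σ-ρ (exceedance (inject₁ i)) λ {π} {σ} → exceedance-cong (inject₁ i) {π} {σ}) ⟩
      Σ[ weak-value (inject₁ i) ] + Σ[ exceedance (inject₁ i) ]
        ≡⟨ sum-map-+ (weak-value (inject₁ i)) (exceedance (inject₁ i)) (toList O) ⟨
      Σ[ ℓ (inject₁ i) ]
        ∎
      where
      succ : suc (toℕ i) ≡ suc (toℕ (inject₁ i))
      succ = cong suc (sym (Fin.toℕ-inject₁ i))

theorem4p3 : (n : ℕ) → 1 ≤ n → (i : Fin n) → IsMesic (S321-setoid n) 1ℚ ρ𝒮 (ℓ i)
theorem4p3 (suc m) _ i O orbit = trans
  (cong (λ s → (ℤ.+ s) / List⁺.length O) (orbit-sum-ℓ ρ𝒮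
    (λ {π} {σ} → ρ𝒮-cong {π = π} {σ}) (λ {π} {σ} → ρ𝒮-injective {π = π} {σ}) Exc-ρ𝒮 {O} orbit i))
  (n/n≡1ℚ (length (List⁺.tail O)))
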